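{- Let $\mathcal{A}, \mathcal{B} \subseteq \mathbb{N}$. If $\mathbf{d}(\mathcal{A}) = \mathbf{d}(\mathcal{B}) = 1$, then $\mathbf{d}(\mathcal{A}\cdot\mathcal{B}) = 1$.
   Context: $\mathbb{N}=\{1,2,3,\dots\}$. For sets $\mathcal{A},\mathcal{B}\subseteq\mathbb{N}$, the product set is $\mathcal{A}\cdot\mathcal{B}:=\{ab : a\in\mathcal{A},\ b\in\mathcal{B}\}$. The natural density of $\mathcal{A}\subseteq\mathbb{N}$ is $\mathbf{d}(\mathcal{A})=\lim_{x\to\infty}\#(\mathcal{A}\cap[1,x])/x$, when this limit exists; the statement $\mathbf{d}(\mathcal{A})=1$ means that this limit exists and equals $1$. -}

module Defs where

open import Data.Nat using (ℕ; suc; _*_; _≤_; _≥_)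
open import Data.Product using (Σ; ∃; ∃-syntax; _×_)
open import Data.List using (List; length)
open import Data.List.Relation.Unary.All using (All)
open import Data.List.Relation.Unary.Unique.Propositional using (Unique)
open import Relation.Binary.PropositionalEquality using (_≡_)

-- A subset of ℕ = {1,2,3,...} is a predicate on Agda's ℕ (elements 0 are
-- irrelevant: only the window [1,x] is ever counted).
Subset : Set₁
Subset = ℕ → Set

_·_ : Subset → Subset → Subset
(A · B) n = ∃[ a ] ∃[ b ] (A a × B b × n ≡ a * b)

AtLeastIn : Subset → ℕ → ℕ → Set
AtLeastIn A x k =
  Σ (List ℕ) λ l → Unique l × All (λ n → 1 ≤ n × n ≤ x × A n) l × length l ≡ k

-- d(A) = 1: since #(A ∩ [1,x]) ≤ x always, the limit exists and equals 1 iff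
-- for every ε = 1/(m+1) there is N with #(A ∩ [1,x]) ≥ (1 - 1/(m+1)) x
-- for all x ≥ N, i.e. (m+1)·#(A ∩ [1,x]) ≥ m·x.
DensityOne : Subset → Set
DensityOne A =
  ∀ (m : ℕ) → ∃[ N ] ∀ (x : ℕ) → x ≥ N →
    ∃[ k ] (AtLeastIn A x k × suc m * k ≥ m * x)

{-# OPTIONS --safe #-}
module Submission where

-- For a fixed a ∈ A almost every multiple of a lies in A · B, so it is enough to find, for almost
-- every n, a divisor a ∈ A of n bounded independently of n.  With z = 2 ^ r and L = lcm(1, …, z²),
-- take a = gcd(n, L).  Outside a set of density at most 1/z the cofactor n / a has no divisor in
-- [2, z + 1]: otherwise n is divisible by one of at most z prescribed numbers exceeding z².  Writing
-- log gcd(n, L) as the sum of the von Mangoldt function over the divisors d ≤ z² of n, one compares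
-- its mean over [1, x] with its mean over [1, z²], which is O(r); so by Markov's inequality
-- a ≤ 2 ^ (K r) outside a set of density O(1/K).  Integers without divisors in [2, z + 1] have
-- density O(1/r), as their dilates by 1, …, z are disjoint.  Hence the n for which a ∉ A have
-- density at most O(1/r) ∑ 1/m over the m ≤ 2 ^ (K r) outside A, and since A has density one the
-- sum is o(r), by splitting it into dyadic blocks.

open import Defs
open import Data.List using (List; []; _∷_; _++_; length)
open import Data.List.Membership.Propositional using (_∈_)
open import Data.List.Membership.Propositional.Properties using (∈-++⁺ˡ; ∈-++⁺ʳ)
open import Data.List.Relation.Unary.All as All using (All; []; _∷_)
open import Data.List.Relation.Unary.All.Properties using (++⁺)
open import Data.List.Relation.Unary.AllPairs using ([]; _∷_)
open import Data.List.Relation.Unary.Unique.Propositional using (Unique)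
open import Data.Nat
open import Data.Nat.Coprimality using (coprime-divisor; gcd≡1⇒coprime)
open import Data.Nat.Divisibility
open import Data.Nat.GCD
open import Data.Nat.LCM
open import Data.Nat.Properties
open import Data.Nat.Tactic.RingSolver using (solve-∀)
open import Data.List.Membership.DecPropositional _≟_ using (_∈?_)
open import Data.Product using (∃; ∃-syntax; _×_; _,_; proj₁; proj₂)
open import Data.Sum using (inj₁; inj₂)
open import Function using (const; id)
open import Relation.Binary.PropositionalEquality hiding (J)
open import Relation.Nullary using (yes; no; contradiction)

-- Sums over [1, x]

∑ : ℕ → (ℕ → ℕ) → ℕ
∑ zero    f = 0
∑ (suc x) f = ∑ x f + f (suc x)

∑-mono : ∀ {f g} x → (∀ i → 1 ≤ i → i ≤ x → f i ≤ g i) → ∑ x f ≤ ∑ x g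
∑-mono zero    f≤g = z≤n
∑-mono (suc x) f≤g =
  +-mono-≤ (∑-mono x λ i 1≤i i≤x → f≤g i 1≤i (m≤n⇒m≤1+n i≤x)) (f≤g (suc x) (s≤s z≤n) ≤-refl)

∑-cong : ∀ {f g} x → (∀ i → 1 ≤ i → i ≤ x → f i ≡ g i) → ∑ x f ≡ ∑ x g
∑-cong zero    f≡g = refl
∑-cong (suc x) f≡g =
  cong₂ _+_ (∑-cong x λ i 1≤i i≤x → f≡g i 1≤i (m≤n⇒m≤1+n i≤x)) (f≡g (suc x) (s≤s z≤n) ≤-refl)

∑-distrib-+ : ∀ f g x → ∑ x (λ i → f i + g i) ≡ ∑ x f + ∑ x g
∑-distrib-+ f g zero    = refl
∑-distrib-+ f g (suc x) rewrite ∑-distrib-+ f g x = lemma (∑ x f) (∑ x g) (f (suc x)) (g (suc x))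
  where
  lemma : ∀ a b c d → a + b + (c + d) ≡ a + c + (b + d)
  lemma = solve-∀

*-distribˡ-∑ : ∀ c f x → c * ∑ x f ≡ ∑ x (λ i → c * f i)
*-distribˡ-∑ c f zero    = *-zeroʳ c
*-distribˡ-∑ c f (suc x) =
  trans (*-distribˡ-+ c (∑ x f) (f (suc x))) (cong (_+ c * f (suc x)) (*-distribˡ-∑ c f x))

∑-const : ∀ c x → ∑ x (const c) ≡ x * c
∑-const c zero    = refl
∑-const c (suc x) rewrite ∑-const c x = +-comm (x * c) c

∑-zero : ∀ x → ∑ x (const 0) ≡ 0
∑-zero x = trans (∑-const 0 x) (*-zeroʳ x)

∑-swap : ∀ (f : ℕ → ℕ → ℕ) x y → ∑ x (λ n → ∑ y (λ m → f m n)) ≡ ∑ y (λ m → ∑ x (f m))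
∑-swap f zero    y = sym (∑-zero y)
∑-swap f (suc x) y rewrite ∑-swap f x y = sym (∑-distrib-+ (λ m → ∑ x (f m)) (λ m → f m (suc x)) y)

∑-split : ∀ f a b → ∑ (a + b) f ≡ ∑ a f + ∑ b (λ i → f (a + i))
∑-split f a zero    rewrite +-identityʳ a = sym (+-identityʳ _)
∑-split f a (suc b) rewrite +-suc a b | ∑-split f a b = +-assoc (∑ a f) _ _

∑-monoˡ : ∀ f {x y} → x ≤ y → ∑ x f ≤ ∑ y f
∑-monoˡ f {x} {y} x≤y = begin
  ∑ x f                                    ≤⟨ m≤m+n _ _ ⟩
  ∑ x f + ∑ (y ∸ x) (λ i → f (x + i))      ≡⟨ ∑-split f x (y ∸ x) ⟨
  ∑ (x + (y ∸ x)) f                        ≡⟨ cong (λ w → ∑ w f) (m+[n∸m]≡n x≤y) ⟩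
  ∑ y f                                    ∎
  where open ≤-Reasoning

term≤∑ : ∀ f x {i} → 1 ≤ i → i ≤ x → f i ≤ ∑ x f
term≤∑ f x {suc i} _ i≤x = ≤-trans (m≤n+m _ _) (∑-monoˡ f i≤x)

∑≡0⇒≡0 : ∀ f x → ∑ x f ≡ 0 → ∀ {i} → 1 ≤ i → i ≤ x → f i ≡ 0
∑≡0⇒≡0 f x ∑≡0 1≤i i≤x = n≤0⇒n≡0 (subst (_ ≤_) ∑≡0 (term≤∑ f x 1≤i i≤x))

∑≤1 : ∀ f x → (∀ i → f i ≤ 1) → (∀ {i j} → 1 ≤ i → i < j → j ≤ x → f j ≢ 0 → f i ≡ 0) → ∑ x f ≤ 1
∑≤1 f zero    f≤1 unique = z≤n
∑≤1 f (suc x) f≤1 unique with f (suc x) ≟ 0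
... | yes f≡0 rewrite f≡0 | +-identityʳ (∑ x f) =
  ∑≤1 f x f≤1 λ 1≤i i<j j≤x → unique 1≤i i<j (m≤n⇒m≤1+n j≤x)
... | no f≢0 rewrite ∑-cong {f} {const 0} x (λ i 1≤i i≤x → unique 1≤i (s≤s i≤x) ≤-refl f≢0) | ∑-zero x =
  f≤1 (suc x)

∑-periodic : ∀ f q → (∀ k → f (q + k) ≡ f k) → ∀ j → ∑ (j * q) f ≡ j * ∑ q f
∑-periodic f q per zero    = refl
∑-periodic f q per (suc j) = begin
  ∑ (q + j * q) f                           ≡⟨ ∑-split f q (j * q) ⟩
  ∑ q f + ∑ (j * q) (λ i → f (q + i))       ≡⟨ cong (∑ q f +_) (∑-cong (j * q) λ i _ _ → per i) ⟩
  ∑ q f + ∑ (j * q) f                       ≡⟨ cong (∑ q f +_) (∑-periodic f q per j) ⟩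
  ∑ q f + j * ∑ q f                         ∎
  where open ≡-Reasoning

-- Dilates and the counting of multiples

-- dilate m f is the function supported on the multiples of m with value f k at k * m.
dilate : ℕ → (ℕ → ℕ) → ℕ → ℕ
dilate m f n with m ∣? n
... | yes (divides q _) = f q
... | no _              = 0

dilate-∣ : ∀ m f k .{{_ : NonZero m}} → dilate m f (k * m) ≡ f k
dilate-∣ m f k with m ∣? (k * m)
... | yes (divides q km≡qm) = cong f (sym (*-cancelʳ-≡ k q m km≡qm))
... | no m∤km            = contradiction (n∣m*n k) m∤km

dilate-∤ : ∀ m f {n} → m ∤ n → dilate m f n ≡ 0
dilate-∤ m f {n} m∤n with m ∣? n
... | yes m∣n = contradiction m∣n m∤n
... | no _  = refl

dilate≢0⇒∣ : ∀ m f {n} → dilate m f n ≢ 0 → ∃ λ q → n ≡ q * m × f q ≢ 0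
dilate≢0⇒∣ m f {n} ≢0 with m ∣? n
... | yes (divides q eq) = q , eq , ≢0
... | no _               = contradiction refl ≢0

dilate-≤ : ∀ m f {c} n → (∀ k → f k ≤ c) → dilate m f n ≤ c
dilate-≤ m f n f≤c with m ∣? n
... | yes (divides q _) = f≤c q
... | no _              = z≤n

-- ⌊ x / m ⌋, obtained by counting multiples.
multiples : ℕ → ℕ → ℕ
multiples m x = ∑ x (dilate m (const 1))

module _ (m : ℕ) .{{_ : NonZero m}} where

  private
    multiples-bounds : ∀ x → multiples m x * m ≤ x × x < suc (multiples m x) * m
    multiples-bounds zero    = z≤n , ≤-trans (>-nonZero⁻¹ m) (m≤m+n m 0)
    multiples-bounds (suc x) with multiples-bounds x | m ∣? suc x
    ... | lo , hi | no m∤ rewrite +-identityʳ (multiples m x) =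
      m≤n⇒m≤1+n lo , ≤∧≢⇒< hi λ eq → m∤ (divides (suc (multiples m x)) eq)
    ... | lo , hi | yes (divides q eq) rewrite +-comm (multiples m x) 1 =
      ≤-trans (*-monoˡ-≤ m {suc (multiples m x)} {q} (*-cancelʳ-< m _ q (subst (multiples m x * m <_) eq (s≤s lo)))) (≤-reflexive (sym eq))
      , ≤-<-trans hi (m<n+m _ (>-nonZero⁻¹ m))

  multiples-lower : ∀ x → multiples m x * m ≤ x
  multiples-lower x = proj₁ (multiples-bounds x)

  multiples-upper : ∀ x → x < suc (multiples m x) * m
  multiples-upper x = proj₂ (multiples-bounds x)

  multiples-* : ∀ q → multiples m (q * m) ≡ q
  multiples-* q = ≤-antisym (*-cancelʳ-≤ _ q m (multiples-lower (q * m)))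
    (s≤s⁻¹ (*-cancelʳ-< m q _ (multiples-upper (q * m))))

  -- Reindexing by n = k * m; when suc x = q * m, the two bounds on `multiples m x` force q to be
  -- its successor.
  ∑-dilate : ∀ f x → ∑ x (dilate m f) ≡ ∑ (multiples m x) f
  ∑-dilate f zero    = refl
  ∑-dilate f (suc x) with m ∣? suc x
  ... | no _ rewrite +-identityʳ (multiples m x) | +-identityʳ (∑ x (dilate m f)) = ∑-dilate f x
  ... | yes (divides q eq) rewrite +-comm (multiples m x) 1 | ∑-dilate f x =
    cong (λ k → ∑ (multiples m x) f + f k) (≤-antisym
      (s≤s⁻¹ (*-cancelʳ-< m q _ (≤-<-trans (≤-reflexive (sym eq)) (≤-<-trans (multiples-upper x) (m<n+m _ (>-nonZero⁻¹ m))))))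
      (*-cancelʳ-< m _ q (subst (multiples m x * m <_) eq (s≤s (multiples-lower x)))))

∑-dilate-const : ∀ m c x .{{_ : NonZero m}} → ∑ x (dilate m (const c)) ≡ multiples m x * c
∑-dilate-const m c x = trans (∑-dilate m (const c) x) (∑-const c (multiples m x))

multiples-antitone : ∀ {m m'} x .{{_ : NonZero m}} → m ≤ m' → multiples m' x ≤ multiples m x
multiples-antitone {m} {m'} x m≤m' = s≤s⁻¹ (*-cancelʳ-< m _ _ (begin-strict
  multiples m' x * m         ≤⟨ *-monoʳ-≤ (multiples m' x) m≤m' ⟩
  multiples m' x * m'        ≤⟨ multiples-lower m' {{>-nonZero (≤-trans (>-nonZero⁻¹ m) m≤m')}} x ⟩
  x                          <⟨ multiples-upper m x ⟩
  suc (multiples m x) * m    ∎))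
  where open ≤-Reasoning

-- The greatest common divisor with lcm(1, …, z)

^-bracket : ∀ t → 2 ≤ t → ∀ n → 1 ≤ n → ∃ λ j → t ^ j ≤ n × n < t ^ suc j
^-bracket t 2≤t (suc zero)    _ = 0 , ≤-refl , subst (2 ≤_) (sym (*-identityʳ t)) 2≤t
^-bracket t 2≤t (suc (suc n)) _ with ^-bracket t 2≤t (suc n) (s≤s z≤n)
... | j , lo , hi with t ^ suc j ≤? suc (suc n)
... | no  ≰ = j , m≤n⇒m≤1+n lo , ≰⇒> ≰
... | yes ≤ = suc j , ≤ , ≤-<-trans hi (^-monoʳ-< t 2≤t (n<1+n (suc j)))

-- An integer stand-in for the base 2 logarithm, within a factor 2: rounding up costs a factor 2 ≤
-- e. The value 1 needs its own case, since it must receive exponent 0.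
log₂-bound : ∀ e → 1 ≤ e → ∃ λ w → e ≤ 2 ^ w × 2 ^ w ≤ e * e
log₂-bound (suc zero)    _ = 0 , ≤-refl , ≤-refl
log₂-bound e@(suc (suc _)) 1≤e with ^-bracket 2 ≤-refl e 1≤e
... | j , lo , hi = suc j , <⇒≤ hi , *-mono-≤ {2} {e} (s≤s (s≤s z≤n)) lo

n<2^n : ∀ n → n < 2 ^ n
n<2^n zero    = ≤-refl
n<2^n (suc n) = begin-strict
  suc n          ≤⟨ n<2^n n ⟩
  2 ^ n          <⟨ ^-monoʳ-< 2 ≤-refl (n<1+n n) ⟩
  2 ^ suc n      ∎
  where open ≤-Reasoning

lcm-*-gcd : ∀ m n → lcm m n * gcd m n ≡ m * n
lcm-*-gcd m n = trans (*-comm (lcm m n) _) (gcd*lcm m n)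

-- A common divisor of s * w and l divides both s * w and l * w, hence gcd l s * w.
gcd-absorb : ∀ s w l → gcd (gcd l s * w) l ≡ gcd (s * w) l
gcd-absorb s w l = ∣-antisym
  (gcd-greatest (∣-trans (gcd[m,n]∣m (gcd l s * w) l) (*-monoˡ-∣ w (gcd[m,n]∣n l s)))
    (gcd[m,n]∣n (gcd l s * w) l))
  (gcd-greatest
    (subst (gcd (s * w) l ∣_) (trans (sym (c*gcd[m,n]≡gcd[cm,cn] w l s)) (*-comm w (gcd l s)))
      (gcd-greatest (∣n⇒∣m*n w g∣l) (subst (gcd (s * w) l ∣_) (*-comm s w) (gcd[m,n]∣m (s * w) l))))
    g∣l)
  where
  g∣l : gcd (s * w) l ∣ l
  g∣l = gcd[m,n]∣n (s * w) l

-- Division-free form of: enlarging l to lcm l s multiplies the gcd with n by s / gcd l s. After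
-- multiplying by h = gcd l s the factor s comes out, and `gcd-absorb` turns h * w back into s * w =
-- n.
gcd-lcm-∣ : ∀ {s n} l → s ∣ n → gcd n (lcm l s) * gcd l s ≡ gcd n l * s
gcd-lcm-∣ {s} l (divides-refl w) = begin
  gcd (w * s) (lcm l s) * h          ≡⟨ *-comm _ h ⟩
  h * gcd (w * s) (lcm l s)          ≡⟨ c*gcd[m,n]≡gcd[cm,cn] h (w * s) (lcm l s) ⟩
  gcd (h * (w * s)) (h * lcm l s)    ≡⟨ cong₂ gcd (lemma h w s) (trans (gcd*lcm l s) (*-comm l s)) ⟩
  gcd (s * (h * w)) (s * l)          ≡⟨ c*gcd[m,n]≡gcd[cm,cn] s (h * w) l ⟨
  s * gcd (h * w) l                  ≡⟨ cong (s *_) (gcd-absorb s w l) ⟩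
  s * gcd (s * w) l                  ≡⟨ *-comm s _ ⟩
  gcd (s * w) l * s                  ≡⟨ cong (λ v → gcd v l * s) (*-comm s w) ⟩
  gcd (w * s) l * s                  ∎
  where
  open ≡-Reasoning
  h = gcd l s
  lemma : ∀ a b c → a * (b * c) ≡ c * (a * b)
  lemma = solve-∀

-- With u the left-hand gcd and h = gcd l s, the product u * h divides l * s and l * u, hence l *
-- gcd s u. The hypothesis makes gcd s u divide h, so cancelling h gives u ∣ l.
gcd-lcm-∤ : ∀ {s} n {l} → .{{NonZero l}} → gcd n s ∣ l → gcd n (lcm l s) ≡ gcd n l
gcd-lcm-∤ {s} n {l} g∣l = ∣-antisym
  (gcd-greatest (gcd[m,n]∣m n _) u∣l)
  (gcd-greatest (gcd[m,n]∣m n l) (∣-trans (gcd[m,n]∣n n l) (m∣lcm[m,n] l s)))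
  where
  u = gcd n (lcm l s)
  h = gcd l s
  instance
    h≢0 : NonZero h
    h≢0 = ≢-nonZero (λ eq → ≢-nonZero⁻¹ l (gcd[m,n]≡0⇒m≡0 eq))
  gcd[s,u]∣h : gcd s u ∣ h
  gcd[s,u]∣h = gcd-greatest
    (∣-trans (gcd-greatest (∣-trans (gcd[m,n]∣n s u) (gcd[m,n]∣m n _)) (gcd[m,n]∣m s u)) g∣l)
    (gcd[m,n]∣m s u)
  u*h∣l*s : u * h ∣ l * s
  u*h∣l*s = subst (u * h ∣_) (lcm-*-gcd l s) (*-monoˡ-∣ h (gcd[m,n]∣n n _))
  u*h∣l*u : u * h ∣ l * u
  u*h∣l*u = subst (u * h ∣_) (*-comm u l) (*-monoʳ-∣ u (gcd[m,n]∣m l s))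
  u∣l : u ∣ l
  u∣l = *-cancelʳ-∣ h (∣-trans
    (subst (u * h ∣_) (sym (c*gcd[m,n]≡gcd[cm,cn] l s u)) (gcd-greatest u*h∣l*s u*h∣l*u))
    (*-monoʳ-∣ l gcd[s,u]∣h))

lcmUpTo : ℕ → ℕ
lcmUpTo zero    = 1
lcmUpTo (suc z) = lcm (lcmUpTo z) (suc z)

lcmUpTo-≢0 : ∀ z → NonZero (lcmUpTo z)
lcmUpTo-≢0 zero    = _
lcmUpTo-≢0 (suc z) = ≢-nonZero λ eq →
  ≢-nonZero⁻¹ (lcmUpTo z * suc z) {{m*n≢0 _ _ {{lcmUpTo-≢0 z}}}}
    (trans (sym (gcd*lcm (lcmUpTo z) (suc z))) (trans (cong (gcd (lcmUpTo z) (suc z) *_) eq) (*-zeroʳ (gcd (lcmUpTo z) (suc z)))))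

∣lcmUpTo : ∀ {d} z → 1 ≤ d → d ≤ z → d ∣ lcmUpTo z
∣lcmUpTo {suc d} zero    _   ()
∣lcmUpTo {d} (suc z) 1≤d d≤z with m≤n⇒m<n∨m≡n d≤z
... | inj₁ (s≤s d≤z') = ∣-trans (∣lcmUpTo z 1≤d d≤z') (m∣lcm[m,n] _ (suc z))
... | inj₂ refl       = n∣lcm[m,n] (lcmUpTo z) (suc z)

-- The exponential of the von Mangoldt function, with the index shifted: lcmRatio z = exp (Λ (z + 1)).
lcmRatio : ℕ → ℕ
lcmRatio z = quotient (m∣lcm[m,n] (lcmUpTo z) (suc z))

lcmRatio-≥1 : ∀ z → 1 ≤ lcmRatio z
lcmRatio-≥1 z = >-nonZero⁻¹ (lcmRatio z) {{quotient≢0 (m∣lcm[m,n] (lcmUpTo z) (suc z)) {{lcmUpTo-≢0 (suc z)}}}}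

gcd-lcmUpTo-∣ : ∀ {n} z → suc z ∣ n → gcd n (lcmUpTo (suc z)) ≡ gcd n (lcmUpTo z) * lcmRatio z
gcd-lcmUpTo-∣ {n} z s∣n = *-cancelʳ-≡ _ _ h {{h≢0}} (begin
  gcd n (lcm l s) * h      ≡⟨ gcd-lcm-∣ l s∣n ⟩
  gcd n l * s              ≡⟨ cong (gcd n l *_) s≡eh ⟩
  gcd n l * (e * h)        ≡⟨ *-assoc (gcd n l) e h ⟨
  gcd n l * e * h          ∎)
  where
  open ≡-Reasoning
  s = suc z
  l = lcmUpTo z
  e = lcmRatio z
  h = gcd l s
  h≢0 : NonZero h
  h≢0 = ≢-nonZero (λ eq → ≢-nonZero⁻¹ l {{lcmUpTo-≢0 z}} (gcd[m,n]≡0⇒m≡0 eq))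
  s≡eh : s ≡ e * h
  s≡eh = *-cancelˡ-≡ s (e * h) l {{lcmUpTo-≢0 z}} (begin
    l * s            ≡⟨ lcm-*-gcd l s ⟨
    lcm l s * h      ≡⟨ cong (_* h) (m∣n⇒n≡m*quotient (m∣lcm[m,n] l s)) ⟩
    l * e * h        ≡⟨ *-assoc l e h ⟩
    l * (e * h)      ∎)

-- Here `gcd n (suc z)` is a proper divisor of suc z, hence at most z, hence a divisor of
-- `lcmUpTo z`.
gcd-lcmUpTo-∤ : ∀ {n} z → suc z ∤ n → gcd n (lcmUpTo (suc z)) ≡ gcd n (lcmUpTo z)
gcd-lcmUpTo-∤ {n} z s∤n = gcd-lcm-∤ n {{lcmUpTo-≢0 z}} (∣lcmUpTo z
  (n≢0⇒n>0 λ eq → 1+n≢0 (gcd[m,n]≡0⇒n≡0 n eq))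
  (s≤s⁻¹ (≤∧≢⇒< (gcd[m,n]≤n n (suc z)) λ eq → s∤n (subst (_∣ n) eq (gcd[m,n]∣m n (suc z))))))

-- The von Mangoldt function in base 2, up to a factor 2.
weight : ℕ → ℕ
weight zero    = 0
weight (suc z) = proj₁ (log₂-bound (lcmRatio z) (lcmRatio-≥1 z))

-- The total weight of the divisors d ≤ z of n, an integer version of log gcd(n, lcm(1, ..., z)).
weightSum : ℕ → ℕ → ℕ
weightSum z n = ∑ z λ d → dilate d (const (weight d)) n

-- As z grows, a new index dividing n multiplies the gcd by `lcmRatio z`, and any other leaves it
-- unchanged; the bounds of `log₂-bound` then multiply up.
weightSum-bounds : ∀ z n → let g = gcd n (lcmUpTo z) in g ≤ 2 ^ weightSum z n × 2 ^ weightSum z n ≤ g * g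
weightSum-bounds zero    n rewrite ∣-antisym (gcd[m,n]∣n n 1) (1∣ gcd n 1) = ≤-refl , ≤-refl
weightSum-bounds (suc z) n with weightSum-bounds z n | suc z ∣? n
... | lo , hi | no s∤n rewrite +-identityʳ (weightSum z n) | gcd-lcmUpTo-∤ z s∤n = lo , hi
... | lo , hi | yes s∣n with log₂-bound (lcmRatio z) (lcmRatio-≥1 z)
... | w , lo' , hi' rewrite gcd-lcmUpTo-∣ z s∣n | ^-distribˡ-+-* 2 (weightSum z n) w =
  *-mono-≤ lo lo' , ≤-trans (*-mono-≤ hi hi') (≤-reflexive (lemma (gcd n (lcmUpTo z)) (lcmRatio z)))
  where
  lemma : ∀ a b → (a * a) * (b * b) ≡ (a * b) * (a * b)
  lemma = solve-∀

-- The mean of weightSum, and the density of rough integers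

∑-weightSum : ∀ z x → ∑ x (weightSum z) ≡ ∑ z (λ d → multiples d x * weight d)
∑-weightSum z x = trans (∑-swap (λ d → dilate d (const (weight d))) x z)
  (∑-cong z λ { d@(suc _) _ _ → ∑-dilate-const d (weight d) x })

-- As d ≤ z, the floor b of z / d is at least 1, whence z < (1 + b) d ≤ 2 b d.
multiples-proportional : ∀ d z x .{{_ : NonZero d}} → d ≤ z → z * multiples d x ≤ 2 * x * multiples d z
multiples-proportional d z x d≤z = begin
  z * a              ≤⟨ *-monoˡ-≤ a (<⇒≤ (multiples-upper d z)) ⟩
  (d + b * d) * a    ≤⟨ *-monoˡ-≤ a (+-monoˡ-≤ (b * d) (m≤n*m d b {{>-nonZero 1≤b}})) ⟩
  (b * d + b * d) * a ≡⟨ lemma a b d ⟩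
  2 * (a * d) * b    ≤⟨ *-monoˡ-≤ b (*-monoʳ-≤ 2 (multiples-lower d x)) ⟩
  2 * x * b          ∎
  where
  open ≤-Reasoning
  a = multiples d x
  b = multiples d z
  1≤b : 1 ≤ b
  1≤b = s≤s⁻¹ (*-cancelʳ-< d 1 (suc b) (≤-<-trans (≤-trans (≤-reflexive (*-identityˡ d)) d≤z) (multiples-upper d z)))
  lemma : ∀ a b d → (b * d + b * d) * a ≡ 2 * (a * d) * b
  lemma = solve-∀

weightSum-mean : ∀ z x → z * ∑ x (weightSum z) ≤ 2 * x * ∑ z (weightSum z)
weightSum-mean z x = begin
  z * ∑ x (weightSum z)                              ≡⟨ cong (z *_) (∑-weightSum z x) ⟩
  z * ∑ z (λ d → multiples d x * weight d)           ≡⟨ *-distribˡ-∑ z _ z ⟩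
  ∑ z (λ d → z * (multiples d x * weight d))         ≤⟨ ∑-mono z (λ { d@(suc _) _ d≤z → termwise d d≤z }) ⟩
  ∑ z (λ d → 2 * x * (multiples d z * weight d))     ≡⟨ *-distribˡ-∑ (2 * x) _ z ⟨
  2 * x * ∑ z (λ d → multiples d z * weight d)       ≡⟨ cong (2 * x *_) (∑-weightSum z z) ⟨
  2 * x * ∑ z (weightSum z)                          ∎
  where
  open ≤-Reasoning
  termwise : ∀ d .{{_ : NonZero d}} → d ≤ z → z * (multiples d x * weight d) ≤ 2 * x * (multiples d z * weight d)
  termwise d d≤z = begin
    z * (multiples d x * weight d)      ≡⟨ *-assoc z (multiples d x) (weight d) ⟨
    z * multiples d x * weight d        ≤⟨ *-monoˡ-≤ (weight d) (multiples-proportional d z x d≤z) ⟩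
    2 * x * multiples d z * weight d    ≡⟨ *-assoc (2 * x) (multiples d z) (weight d) ⟩
    2 * x * (multiples d z * weight d)  ∎

2^-cancel-≤ : ∀ a b → 2 ^ a ≤ 2 ^ b → a ≤ b
2^-cancel-≤ a b 2^a≤2^b with a ≤? b
... | yes a≤b = a≤b
... | no  a≰b = contradiction 2^a≤2^b (<⇒≱ (^-monoʳ-< 2 ≤-refl (≰⇒> a≰b)))

weightSum-≤ : ∀ s n → 1 ≤ n → n ≤ 2 ^ s → weightSum (2 ^ s) n ≤ s + s
weightSum-≤ s n 1≤n n≤2^s = 2^-cancel-≤ _ (s + s) (begin
  2 ^ weightSum (2 ^ s) n  ≤⟨ proj₂ (weightSum-bounds (2 ^ s) n) ⟩
  g * g                    ≤⟨ *-mono-≤ g≤2^s g≤2^s ⟩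
  2 ^ s * 2 ^ s            ≡⟨ ^-distribˡ-+-* 2 s s ⟨
  2 ^ (s + s)              ∎)
  where
  open ≤-Reasoning
  g = gcd n (lcmUpTo (2 ^ s))
  g≤2^s : g ≤ 2 ^ s
  g≤2^s = ≤-trans (∣⇒≤ {{>-nonZero 1≤n}} (gcd[m,n]∣m n _)) n≤2^s

-- Takes the place of Mertens' estimate for the sum of Λ(d) / d. The mean over [1, 2 ^ s] is at most
-- 2 s merely because the gcd with n is at most n, and passing to [1, x] costs a factor 2.
∑-weightSum-≤ : ∀ s x → ∑ x (weightSum (2 ^ s)) ≤ 4 * s * x
∑-weightSum-≤ s x = *-cancelˡ-≤ z {{m^n≢0 2 s}} (begin
  z * ∑ x (weightSum z)       ≤⟨ weightSum-mean z x ⟩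
  2 * x * ∑ z (weightSum z)   ≤⟨ *-monoʳ-≤ (2 * x) (∑-mono z (weightSum-≤ s)) ⟩
  2 * x * ∑ z (const (s + s)) ≡⟨ cong (2 * x *_) (∑-const (s + s) z) ⟩
  2 * x * (z * (s + s))       ≡⟨ lemma x z s ⟩
  z * (4 * s * x)             ∎)
  where
  open ≤-Reasoning
  z = 2 ^ s
  lemma : ∀ x z s → 2 * x * (z * (s + s)) ≡ z * (4 * s * x)
  lemma = solve-∀

-- The indicator function of the integers with no divisor in [2, z + 1].
rough : ℕ → ℕ → ℕ
rough z k = 1 ∸ ∑ z λ t → dilate (suc t) (const 1) k

rough≡0 : ∀ z k → rough z k ≡ 0 → ∃ λ t → 1 ≤ t × t ≤ z × suc t ∣ k
rough≡0 (suc z) k eq with suc (suc z) ∣? k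
... | yes t∣k = suc z , s≤s z≤n , ≤-refl , t∣k
... | no  _ with rough≡0 z k (trans (cong (1 ∸_) (sym (+-identityʳ (∑ z λ t → dilate (suc t) (const 1) k)))) eq)
... | t , 1≤t , t≤z , t∣k = t , 1≤t , m≤n⇒m≤1+n t≤z , t∣k

rough≢0⇒∤ : ∀ {z k} → rough z k ≢ 0 → ∀ {t} → 1 ≤ t → t ≤ z → suc t ∤ k
rough≢0⇒∤ {z} {k} ≢0 {t} 1≤t t≤z (divides q refl) = ≢0 (m≤n⇒m∸n≡0 (begin
  1                                            ≡⟨ dilate-∣ (suc t) (const 1) q ⟨
  dilate (suc t) (const 1) (q * suc t)         ≤⟨ term≤∑ (λ t → dilate (suc t) (const 1) k) z 1≤t t≤z ⟩
  ∑ z (λ t → dilate (suc t) (const 1) k)       ∎))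
  where open ≤-Reasoning

∣! : ∀ {d n} → 1 ≤ d → d ≤ n → d ∣ n !
∣! {suc d} _ d≤n = ∣-trans (m∣m*n (d !)) (m≤n⇒m!∣n! d≤n)

dilate-1-periodic : ∀ d q k .{{_ : NonZero d}} → d ∣ q → dilate d (const 1) (q + k) ≡ dilate d (const 1) k
dilate-1-periodic d q k d∣q with d ∣? k
... | yes d∣k with ∣m∣n⇒∣m+n d∣q d∣k
...   | divides p eq rewrite eq = dilate-∣ d (const 1) p
dilate-1-periodic d q k d∣q | no d∤k = dilate-∤ d (const 1) λ d∣q+k → d∤k (∣m+n∣m⇒∣n d∣q+k d∣q)

rough-periodic : ∀ z k → rough z (suc z ! + k) ≡ rough z k
rough-periodic z k = cong (1 ∸_) (∑-cong z λ t 1≤t t≤z →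
  dilate-1-periodic (suc t) (suc z !) k (∣! (s≤s z≤n) (s≤s t≤z)))

-- If q has no divisor in [2, z + 1] then it is coprime to each j ≤ z, so j ∣ q * i gives j ∣ i.
∑-dilate-rough≤1 : ∀ z n → ∑ z (λ m → dilate m (rough z) n) ≤ 1
∑-dilate-rough≤1 z n = ∑≤1 _ z (λ m → dilate-≤ m (rough z) n λ k → m∸n≤m 1 (∑ z λ t → dilate (suc t) (const 1) k)) unique
  where
  unique : ∀ {i j} → 1 ≤ i → i < j → j ≤ z → dilate j (rough z) n ≢ 0 → dilate i (rough z) n ≡ 0
  unique {i} {j} 1≤i i<j j≤z ≢0 with dilate i (rough z) n ≟ 0
  ... | yes ≡0 = ≡0
  ... | no ≢0' with dilate≢0⇒∣ i _ ≢0' | dilate≢0⇒∣ j _ ≢0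
  ... | q , n≡qi , rough-q | q' , n≡q'j , _ = contradiction (∣⇒≤ {{>-nonZero 1≤i}} j∣i) (<⇒≱ i<j)
    where
    coprime : gcd j q ≡ 1
    coprime with gcd j q in eq
    ... | zero = contradiction (gcd[m,n]≡0⇒m≡0 eq) (>⇒≢ (≤-trans (s≤s z≤n) i<j))
    ... | suc zero = refl
    ... | suc (suc t) = contradiction (subst (_∣ q) eq (gcd[m,n]∣n j q))
      (rough≢0⇒∤ rough-q (s≤s z≤n) (≤-trans (n≤1+n (suc t)) (≤-trans (∣⇒≤ {{>-nonZero (≤-trans (s≤s z≤n) i<j)}} (subst (_∣ j) eq (gcd[m,n]∣m j q))) j≤z)))
    j∣i : j ∣ i
    j∣i = coprime-divisor (gcd≡1⇒coprime coprime) (divides q' (trans (sym n≡qi) n≡q'j))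

multiples-*ˡ : ∀ m c q .{{_ : NonZero m}} → m ∣ q → multiples m (c * q) ≡ c * multiples m q
multiples-*ˡ m c _ (divides-refl p) = begin
  multiples m (c * (p * m))  ≡⟨ cong (multiples m) (*-assoc c p m) ⟨
  multiples m (c * p * m)    ≡⟨ multiples-* m (c * p) ⟩
  c * p                      ≡⟨ cong (c *_) (multiples-* m p) ⟨
  c * multiples m (p * m)    ∎
  where open ≡-Reasoning

multiples-∣ : ∀ m q .{{_ : NonZero m}} → m ∣ q → multiples m q * m ≡ q
multiples-∣ m _ (divides-refl p) = cong (_* m) (multiples-* m p)

-- Each dyadic block of the harmonic series adds at least 1/2. After multiplication by q, every term
-- q / m is an exact integer by the divisibility hypothesis.
harmonic-lower : ∀ q i → (∀ m → 1 ≤ m → m ≤ 2 ^ i → m ∣ q) → i * q ≤ 2 * ∑ (2 ^ i) (λ m → multiples m q)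
harmonic-lower q zero    _     = z≤n
harmonic-lower q (suc i) all∣q = begin
  q + i * q                                   ≤⟨ +-mono-≤ block (harmonic-lower q i λ m 1≤m m≤2^i → all∣q m 1≤m (≤-trans m≤2^i (m≤m+n _ _))) ⟩
  2 * ∑ (2 ^ i) (λ m → f (2 ^ i + m)) + 2 * ∑ (2 ^ i) f
                                              ≡⟨ lemma _ (∑ (2 ^ i) f) ⟩
  2 * (∑ (2 ^ i) f + ∑ (2 ^ i) (λ m → f (2 ^ i + m)))
                                              ≡⟨ cong (2 *_) (∑-split f (2 ^ i) (2 ^ i)) ⟨
  2 * ∑ (2 ^ i + 2 ^ i) f                     ≡⟨ cong (λ v → 2 * ∑ (2 ^ i + v) f) (+-identityʳ (2 ^ i)) ⟨
  2 * ∑ (2 ^ suc i) f                         ∎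
  where
  open ≤-Reasoning
  f : ℕ → ℕ
  f m = multiples m q
  lemma : ∀ a b → 2 * a + 2 * b ≡ 2 * (b + a)
  lemma = solve-∀
  lemma' : ∀ a b → 2 * (a * b) ≡ b * (2 * a)
  lemma' = solve-∀
  termwise : ∀ m → 1 ≤ m → m ≤ 2 ^ i → q ≤ 2 ^ suc i * f (2 ^ i + m)
  termwise m 1≤m m≤2^i = begin
    q                              ≡⟨ multiples-∣ (2 ^ i + m) q {{nz}} (all∣q _ (≤-trans 1≤m (m≤n+m m _)) le) ⟨
    f (2 ^ i + m) * (2 ^ i + m)    ≤⟨ *-monoʳ-≤ (f (2 ^ i + m)) le ⟩
    f (2 ^ i + m) * 2 ^ suc i      ≡⟨ *-comm (f (2 ^ i + m)) _ ⟩
    2 ^ suc i * f (2 ^ i + m)      ∎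
    where
    nz : NonZero (2 ^ i + m)
    nz = >-nonZero (≤-trans 1≤m (m≤n+m m _))
    le : 2 ^ i + m ≤ 2 ^ suc i
    le = +-monoʳ-≤ (2 ^ i) (≤-trans m≤2^i (m≤m+n _ 0))
  block : q ≤ 2 * ∑ (2 ^ i) (λ m → f (2 ^ i + m))
  block = *-cancelˡ-≤ (2 ^ i) {{m^n≢0 2 i}} (begin
    2 ^ i * q                                      ≡⟨ ∑-const q (2 ^ i) ⟨
    ∑ (2 ^ i) (const q)                            ≤⟨ ∑-mono (2 ^ i) termwise ⟩
    ∑ (2 ^ i) (λ m → 2 ^ suc i * f (2 ^ i + m))    ≡⟨ *-distribˡ-∑ (2 ^ suc i) _ (2 ^ i) ⟨
    2 ^ suc i * ∑ (2 ^ i) (λ m → f (2 ^ i + m))    ≡⟨ cong (_* ∑ (2 ^ i) (λ m → f (2 ^ i + m))) (*-comm 2 (2 ^ i)) ⟩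
    2 ^ i * 2 * ∑ (2 ^ i) (λ m → f (2 ^ i + m))    ≡⟨ *-assoc (2 ^ i) 2 _ ⟩
    2 ^ i * (2 * ∑ (2 ^ i) (λ m → f (2 ^ i + m)))  ∎)

module _ (r : ℕ) where

  private
    z Q φ : ℕ
    z = 2 ^ r
    Q = suc z !
    φ = ∑ Q (rough z)
    instance
      Q≢0 : NonZero Q
      Q≢0 = suc z !≢0
    small∣Q : ∀ m → 1 ≤ m → m ≤ z → m ∣ Q
    small∣Q m 1≤m m≤z = ∣! 1≤m (m≤n⇒m≤1+n m≤z)

  -- The dilates of the rough integers by 1, ..., z are disjoint. In [1, Q * Q] the dilate by m
  -- comes from exactly Q / m full periods, with φ rough integers in each.
  rough-totient : ∑ z (λ m → multiples m Q) * φ ≤ Q * Q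
  rough-totient = begin
    ∑ z (λ m → multiples m Q) * φ                ≡⟨ *-comm _ φ ⟩
    φ * ∑ z (λ m → multiples m Q)                ≡⟨ *-distribˡ-∑ φ _ z ⟩
    ∑ z (λ m → φ * multiples m Q)                ≡⟨ ∑-cong z (λ { m@(suc _) 1≤m m≤z → termwise m 1≤m m≤z }) ⟩
    ∑ z (λ m → ∑ (Q * Q) (dilate m (rough z)))   ≡⟨ ∑-swap (λ m → dilate m (rough z)) (Q * Q) z ⟨
    ∑ (Q * Q) (λ n → ∑ z (λ m → dilate m (rough z) n))
                                                 ≤⟨ ∑-mono (Q * Q) (λ n _ _ → ∑-dilate-rough≤1 z n) ⟩
    ∑ (Q * Q) (const 1)                          ≡⟨ trans (∑-const 1 (Q * Q)) (*-identityʳ _) ⟩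
    Q * Q                                        ∎
    where
    open ≤-Reasoning
    termwise : ∀ m .{{_ : NonZero m}} → 1 ≤ m → m ≤ z → φ * multiples m Q ≡ ∑ (Q * Q) (dilate m (rough z))
    termwise m 1≤m m≤z = begin-equality
      φ * multiples m Q                  ≡⟨ *-comm φ _ ⟩
      multiples m Q * φ                  ≡⟨ ∑-periodic (rough z) Q (rough-periodic z) (multiples m Q) ⟨
      ∑ (multiples m Q * Q) (rough z)    ≡⟨ cong (λ v → ∑ v (rough z)) (*-comm (multiples m Q) Q) ⟩
      ∑ (Q * multiples m Q) (rough z)    ≡⟨ cong (λ v → ∑ v (rough z)) (multiples-*ˡ m Q Q (small∣Q m 1≤m m≤z)) ⟨
      ∑ (multiples m (Q * Q)) (rough z)  ≡⟨ ∑-dilate m (rough z) (Q * Q) ⟨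
      ∑ (Q * Q) (dilate m (rough z))     ∎

  -- The Mertens upper bound φ / Q = O(1 / log z): the harmonic sum over m ≤ 2 ^ r is at least r /
  -- 2.
  rough-density : r * φ ≤ 2 * Q
  rough-density = *-cancelˡ-≤ Q (begin
    Q * (r * φ)                              ≡⟨ lemma Q r φ ⟩
    r * Q * φ                                ≤⟨ *-monoˡ-≤ φ (harmonic-lower Q r small∣Q) ⟩
    2 * ∑ z (λ m → multiples m Q) * φ        ≡⟨ *-assoc 2 (∑ z (λ m → multiples m Q)) φ ⟩
    2 * (∑ z (λ m → multiples m Q) * φ)      ≤⟨ *-monoʳ-≤ 2 rough-totient ⟩
    2 * (Q * Q)                              ≡⟨ lemma' Q ⟩
    Q * (2 * Q)                              ∎)
    where
    open ≤-Reasoning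
    lemma : ∀ a b c → a * (b * c) ≡ b * a * c
    lemma = solve-∀
    lemma' : ∀ a → 2 * (a * a) ≡ a * (2 * a)
    lemma' = solve-∀

  rough-count : ∀ x → r * ∑ x (rough z) ≤ 2 * (Q + x)
  rough-count x = begin
    r * ∑ x (rough z)         ≤⟨ *-monoʳ-≤ r (∑-monoˡ (rough z) (<⇒≤ (multiples-upper Q x))) ⟩
    r * ∑ (j * Q) (rough z)   ≡⟨ cong (r *_) (∑-periodic (rough z) Q (rough-periodic z) j) ⟩
    r * (j * φ)               ≡⟨ lemma r j φ ⟩
    j * (r * φ)               ≤⟨ *-monoʳ-≤ j rough-density ⟩
    j * (2 * Q)               ≡⟨ lemma j 2 Q ⟩
    2 * (j * Q)               ≤⟨ *-monoʳ-≤ 2 (+-monoʳ-≤ Q (multiples-lower Q x)) ⟩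
    2 * (Q + x)               ∎
    where
    open ≤-Reasoning
    -- Enough full periods of length Q to cover [1, x].
    j = suc (multiples Q x)
    lemma : ∀ a b c → a * (b * c) ≡ b * (a * c)
    lemma = solve-∀

-- Densities

zeros : (ℕ → ℕ) → ℕ → List ℕ
zeros f zero = []
zeros f (suc x) with f (suc x) ≟ 0
... | yes _ = suc x ∷ zeros f x
... | no  _ = zeros f x

zeros-All : ∀ f x → All (λ n → 1 ≤ n × n ≤ x × f n ≡ 0) (zeros f x)
zeros-All f zero = []
zeros-All f (suc x) with f (suc x) ≟ 0 | All.map (λ { (1≤n , n≤x , eq) → 1≤n , m≤n⇒m≤1+n n≤x , eq }) (zeros-All f x)
... | yes eq | rest = (s≤s z≤n , ≤-refl , eq) ∷ rest
... | no  _  | rest = rest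

zeros-Unique : ∀ f x → Unique (zeros f x)
zeros-Unique f zero = []
zeros-Unique f (suc x) with f (suc x) ≟ 0
... | yes _ = All.map (λ { (_ , n≤x , _) → >⇒≢ (s≤s n≤x) }) (zeros-All f x) ∷ zeros-Unique f x
... | no  _ = zeros-Unique f x

-- Every n in [1, x] is either listed or adds at least 1 to the sum. Values of f above 1 are
-- allowed, so that the weights of overlapping exceptional sets can simply be added.
zeros-length : ∀ f x → x ≤ length (zeros f x) + ∑ x f
zeros-length f zero = z≤n
zeros-length f (suc x) with f (suc x) ≟ 0
... | yes eq rewrite eq | +-identityʳ (∑ x f) = s≤s (zeros-length f x)
... | no  ≢0 = begin
  suc x                                          ≡⟨ +-comm 1 x ⟩
  x + 1                                          ≤⟨ +-mono-≤ (zeros-length f x) (n≢0⇒n>0 ≢0) ⟩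
  length (zeros f x) + ∑ x f + f (suc x)         ≡⟨ +-assoc (length (zeros f x)) _ _ ⟩
  length (zeros f x) + (∑ x f + f (suc x))       ∎
  where open ≤-Reasoning

density-from-weights : ∀ {A : Subset} m x f → (∀ {n} → 1 ≤ n → n ≤ x → f n ≡ 0 → A n) → suc m * ∑ x f ≤ x →
                       ∃[ k ] (AtLeastIn A x k × suc m * k ≥ m * x)
density-from-weights m x f f≡0⇒A few =
  length (zeros f x)
  , (zeros f x , zeros-Unique f x
    , All.map (λ { (1≤n , n≤x , eq) → 1≤n , n≤x , f≡0⇒A 1≤n n≤x eq }) (zeros-All f x) , refl)
  , +-cancelʳ-≤ x _ _ (begin
      m * x + x                                            ≡⟨ +-comm _ x ⟩
      suc m * x                                            ≤⟨ *-monoʳ-≤ (suc m) (zeros-length f x) ⟩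
      suc m * (length (zeros f x) + ∑ x f)                 ≡⟨ *-distribˡ-+ (suc m) (length (zeros f x)) _ ⟩
      suc m * length (zeros f x) + suc m * ∑ x f           ≤⟨ +-monoʳ-≤ _ few ⟩
      suc m * length (zeros f x) + x                       ∎)
  where open ≤-Reasoning

δ : ℕ → ℕ → ℕ
δ a n with a ≟ n
... | yes _ = 1
... | no  _ = 0

δ-≢ : ∀ {a n} → a ≢ n → δ a n ≡ 0
δ-≢ {a} {n} a≢n with a ≟ n
... | yes a≡n = contradiction a≡n a≢n
... | no  _   = refl

∑-δ : ∀ {a} x → 1 ≤ a → a ≤ x → ∑ x (δ a) ≡ 1
∑-δ {suc a} zero    _   ()
∑-δ {a} (suc x) 1≤a a≤x with a ≟ suc x
... | yes refl = cong (_+ 1) (trans (∑-cong x λ i _ i≤x → δ-≢ (>⇒≢ (s≤s i≤x))) (∑-zero x))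
... | no  a≢   = trans (+-identityʳ _) (∑-δ x 1≤a (s≤s⁻¹ (≤∧≢⇒< a≤x a≢)))

occurrences : List ℕ → ℕ → ℕ
occurrences []      n = 0
occurrences (a ∷ l) n = δ a n + occurrences l n

∑-occurrences : ∀ {l x} → All (λ n → 1 ≤ n × n ≤ x) l → ∑ x (occurrences l) ≡ length l
∑-occurrences {[]}    {x} []                   = ∑-zero x
∑-occurrences {a ∷ l} {x} ((1≤a , a≤x) ∷ rest) =
  trans (∑-distrib-+ (δ a) (occurrences l) x) (cong₂ _+_ (∑-δ x 1≤a a≤x) (∑-occurrences rest))

occurrences-∉ : ∀ {n l} → All (_≢ n) l → occurrences l n ≡ 0
occurrences-∉ [] = refl
occurrences-∉ (a≢n ∷ rest) = cong₂ _+_ (δ-≢ a≢n) (occurrences-∉ rest)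

occurrences-Unique : ∀ {l} n → Unique l → occurrences l n ≤ 1
occurrences-Unique n [] = z≤n
occurrences-Unique {a ∷ l} n (a∉l ∷ unique) with a ≟ n
... | yes refl = ≤-reflexive (cong suc (occurrences-∉ (All.map (λ a≢b b≡a → a≢b (sym b≡a)) a∉l)))
... | no  _    = occurrences-Unique n unique

missing : List ℕ → ℕ → ℕ
missing l n with n ∈? l
... | yes _ = 0
... | no  _ = 1

missing≤1 : ∀ l n → missing l n ≤ 1
missing≤1 l n with n ∈? l
... | yes _ = z≤n
... | no  _ = ≤-refl

missing≡0 : ∀ l n → missing l n ≡ 0 → n ∈ l
missing≡0 l n eq with n ∈? l
... | yes n∈l = n∈l

-- No n is counted twice: it occurs at most once in l, and if it does then it is not missing from L.
length+∑-missing : ∀ {l L x} → Unique l → All (λ n → 1 ≤ n × n ≤ x) l → (∀ {n} → n ∈ l → n ∈ L) →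
                   length l + ∑ x (missing L) ≤ x
length+∑-missing {l} {L} {x} unique inRange l⊆L = begin
  length l + ∑ x (missing L)                   ≡⟨ cong (_+ ∑ x (missing L)) (∑-occurrences inRange) ⟨
  ∑ x (occurrences l) + ∑ x (missing L)        ≡⟨ ∑-distrib-+ (occurrences l) (missing L) x ⟨
  ∑ x (λ n → occurrences l n + missing L n)    ≤⟨ ∑-mono x (λ n _ _ → atMostOne n) ⟩
  ∑ x (const 1)                                ≡⟨ trans (∑-const 1 x) (*-identityʳ x) ⟩
  x                                            ∎
  where
  open ≤-Reasoning
  atMostOne : ∀ n → occurrences l n + missing L n ≤ 1
  atMostOne n with n ∈? L
  ... | yes _   = ≤-trans (≤-reflexive (+-identityʳ _)) (occurrences-Unique n unique)
  ... | no  n∉L = ≤-reflexive (cong (_+ 1) (occurrences-∉ (All.tabulate λ { a∈l refl → n∉L (l⊆L a∈l) })))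

-- Membership in A is not decidable; below a bound y it is replaced by membership in a finite
-- sublist of A, represented through the indicator ν of its complement.
density-weights : ∀ {A : Subset} m N → (∀ x → x ≥ N → ∃[ k ] (AtLeastIn A x k × suc m * k ≥ m * x)) → ∀ y →
                  ∃ λ ν → (∀ n → ν n ≤ 1) × (∀ n → ν n ≡ 0 → A n) × (∀ x → N ≤ x → x ≤ y → suc m * ∑ x ν ≤ x)
density-weights {A} m N dense y = let L , L⊆A , covers = collect y in
  missing L , missing≤1 L , (λ n eq → All.lookup L⊆A (missing≡0 L n eq)) , λ x N≤x x≤y → bound L x (covers x N≤x x≤y)
  where
  Covers : List ℕ → ℕ → Set
  Covers L x = ∃[ l ] (Unique l × All (λ n → 1 ≤ n × n ≤ x) l × (∀ {n} → n ∈ l → n ∈ L) × suc m * length l ≥ m * x)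

  -- One list has to serve every x in [N, y], so the lists for the single x are concatenated;
  -- repetitions are harmless, as only membership in L is used.
  collect : ∀ y → ∃[ L ] (All A L × ∀ x → N ≤ x → x ≤ y → Covers L x)
  collect-at : ∀ x → N ≤ x → ∃[ l ] (All A l × Covers l x)
  collect-at x N≤x with dense x N≤x
  ... | _ , (l , unique , all , refl) , many =
    l , All.map (λ { (_ , _ , n∈A) → n∈A }) all
    , l , unique , All.map (λ { (1≤n , n≤x , _) → 1≤n , n≤x }) all , id , many
  collect zero with N ≟ 0
  ... | yes refl = let l , l⊆A , c = collect-at 0 z≤n in l , l⊆A , λ { .0 _ z≤n → c }
  ... | no  N≢0  = [] , [] , λ { .0 N≤0 z≤n → contradiction (n≤0⇒n≡0 N≤0) N≢0 }
  collect (suc y) with collect y | N ≤? suc y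
  ... | L , L⊆A , covers | no  N≰ = L , L⊆A , λ x N≤x x≤y → covers x N≤x (s≤s⁻¹ (≤∧≢⇒< x≤y λ { refl → N≰ N≤x }))
  ... | L , L⊆A , covers | yes N≤ with collect-at (suc y) N≤
  ... | l' , l'⊆A , l , unique , range , l⊆l' , many = l' ++ L , ++⁺ l'⊆A L⊆A , covers'
    where
    covers' : ∀ x → N ≤ x → x ≤ suc y → Covers (l' ++ L) x
    covers' x N≤x x≤y with m≤n⇒m<n∨m≡n x≤y
    ... | inj₂ refl = l , unique , range , (λ n∈l → ∈-++⁺ˡ (l⊆l' n∈l)) , many
    ... | inj₁ (s≤s x≤y') with covers x N≤x x≤y'
    ... | l₁ , u₁ , r₁ , ⊆₁ , m₁ = l₁ , u₁ , r₁ , (λ n∈l → ∈-++⁺ʳ l' (⊆₁ n∈l)) , m₁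

  bound : ∀ L x → Covers L x → suc m * ∑ x (missing L) ≤ x
  bound L x (l , unique , range , l⊆L , many) = +-cancelˡ-≤ (suc m * length l) _ _ (begin
    suc m * length l + suc m * ∑ x (missing L)   ≡⟨ *-distribˡ-+ (suc m) (length l) _ ⟨
    suc m * (length l + ∑ x (missing L))         ≤⟨ *-monoʳ-≤ (suc m) (length+∑-missing unique range l⊆L) ⟩
    x + m * x                                    ≤⟨ +-monoʳ-≤ x many ⟩
    x + suc m * length l                         ≡⟨ +-comm x _ ⟩
    suc m * length l + x                         ∎)
    where open ≤-Reasoning

-- Floor sums over a sparse set, by dyadic blocks

module _ (ν : ℕ → ℕ) (ν≤1 : ∀ n → ν n ≤ 1) (x : ℕ) where

  -- Up to rounding, x times the sum of 1 / m over the m ≤ y with ν m = 1.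
  weightedFloors : ℕ → ℕ
  weightedFloors y = ∑ y λ m → ν m * multiples m x

  private
    block : ℕ → ℕ
    block i = ∑ (2 ^ i) λ m → ν (2 ^ i + m) * multiples (2 ^ i + m) x

    2^suc : ∀ i → 2 ^ suc i ≡ 2 ^ i + 2 ^ i
    2^suc i = cong (2 ^ i +_) (+-identityʳ (2 ^ i))

    weightedFloors-suc : ∀ i → weightedFloors (2 ^ suc i) ≡ weightedFloors (2 ^ i) + block i
    weightedFloors-suc i = trans (cong weightedFloors (2^suc i)) (∑-split _ (2 ^ i) (2 ^ i))

    floor : ℕ → ℕ
    floor i = multiples (2 ^ i) x

    2^*floor≤x : ∀ i → 2 ^ i * floor i ≤ x
    2^*floor≤x i = ≤-trans (≤-reflexive (*-comm (2 ^ i) _)) (multiples-lower (2 ^ i) {{m^n≢0 2 i}} x)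

    block-≤ : ∀ i → block i ≤ floor i * ∑ (2 ^ i) (λ m → ν (2 ^ i + m))
    block-≤ i = begin
      block i                                        ≤⟨ ∑-mono (2 ^ i) (λ m _ _ → *-monoʳ-≤ (ν (2 ^ i + m)) (multiples-antitone x {{m^n≢0 2 i}} (m≤m+n (2 ^ i) m))) ⟩
      ∑ (2 ^ i) (λ m → ν (2 ^ i + m) * floor i)      ≡⟨ ∑-cong (2 ^ i) (λ m _ _ → *-comm (ν (2 ^ i + m)) (floor i)) ⟩
      ∑ (2 ^ i) (λ m → floor i * ν (2 ^ i + m))      ≡⟨ *-distribˡ-∑ (floor i) _ (2 ^ i) ⟨
      floor i * ∑ (2 ^ i) (λ m → ν (2 ^ i + m))      ∎
      where open ≤-Reasoning

  -- The term m = 1 and each of the i dyadic blocks contribute at most x.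
  weightedFloors-trivial : ∀ i → weightedFloors (2 ^ i) ≤ suc i * x
  weightedFloors-trivial zero = *-mono-≤ (ν≤1 1) (≤-trans (≤-reflexive (sym (*-identityʳ _))) (multiples-lower 1 x))
  weightedFloors-trivial (suc i) = begin
    weightedFloors (2 ^ suc i)                                ≡⟨ weightedFloors-suc i ⟩
    weightedFloors (2 ^ i) + block i                          ≤⟨ +-mono-≤ (weightedFloors-trivial i) (block-≤ i) ⟩
    suc i * x + floor i * ∑ (2 ^ i) (λ m → ν (2 ^ i + m))     ≤⟨ +-monoʳ-≤ (suc i * x) (*-monoʳ-≤ (floor i) (∑-mono (2 ^ i) λ m _ _ → ν≤1 _)) ⟩
    suc i * x + floor i * ∑ (2 ^ i) (const 1)                 ≡⟨ cong (λ v → suc i * x + floor i * v) (trans (∑-const 1 (2 ^ i)) (*-identityʳ _)) ⟩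
    suc i * x + floor i * 2 ^ i                               ≤⟨ +-monoʳ-≤ (suc i * x) (≤-trans (≤-reflexive (*-comm (floor i) _)) (2^*floor≤x i)) ⟩
    suc i * x + x                                             ≡⟨ +-comm (suc i * x) x ⟩
    suc (suc i) * x                                           ∎
    where open ≤-Reasoning

  -- Up to 2 ^ i₀ the trivial bound is used. In a later block (2 ^ i, 2 ^ (i + 1)] the sum of ν is
  -- at most 2 ^ (i + 1) / D and each floor is at most x / 2 ^ i, so the block adds at most 2 x / D.
  weightedFloors-sparse : ∀ D i₀ k → (∀ i → i₀ ≤ i → i ≤ i₀ + k → D * ∑ (2 ^ i) ν ≤ 2 ^ i) →
                          D * weightedFloors (2 ^ (i₀ + k)) ≤ D * (suc i₀ * x) + k * (2 * x)
  weightedFloors-sparse D i₀ zero sparse rewrite +-identityʳ i₀ =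
    ≤-trans (*-monoʳ-≤ D (weightedFloors-trivial i₀)) (m≤m+n _ 0)
  weightedFloors-sparse D i₀ (suc k) sparse rewrite +-suc i₀ k = begin
    D * weightedFloors (2 ^ suc i)                         ≡⟨ cong (D *_) (weightedFloors-suc i) ⟩
    D * (weightedFloors (2 ^ i) + block i)                 ≡⟨ *-distribˡ-+ D _ (block i) ⟩
    D * weightedFloors (2 ^ i) + D * block i               ≤⟨ +-mono-≤ (weightedFloors-sparse D i₀ k (λ j i₀≤j j≤ → sparse j i₀≤j (m≤n⇒m≤1+n j≤))) D*block ⟩
    D * (suc i₀ * x) + k * (2 * x) + 2 * x                 ≡⟨ +-assoc (D * (suc i₀ * x)) _ _ ⟩
    D * (suc i₀ * x) + (k * (2 * x) + 2 * x)               ≡⟨ cong (D * (suc i₀ * x) +_) (+-comm _ (2 * x)) ⟩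
    D * (suc i₀ * x) + suc k * (2 * x)                     ∎
    where
    open ≤-Reasoning
    i : ℕ
    i = i₀ + k
    lemma : ∀ a b c → a * (b * c) ≡ b * (a * c)
    lemma = solve-∀
    lemma' : ∀ a b → a * (2 * b) ≡ 2 * (b * a)
    lemma' = solve-∀
    upper-half : ∑ (2 ^ i) (λ m → ν (2 ^ i + m)) ≤ ∑ (2 ^ suc i) ν
    upper-half = ≤-trans (m≤n+m _ _) (≤-reflexive (sym (trans (cong (λ v → ∑ v ν) (2^suc i)) (∑-split ν (2 ^ i) (2 ^ i)))))
    D*block : D * block i ≤ 2 * x
    D*block = begin
      D * block i                           ≤⟨ *-monoʳ-≤ D (≤-trans (block-≤ i) (*-monoʳ-≤ (floor i) upper-half)) ⟩
      D * (floor i * ∑ (2 ^ suc i) ν)       ≡⟨ lemma D (floor i) _ ⟩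
      floor i * (D * ∑ (2 ^ suc i) ν)       ≤⟨ *-monoʳ-≤ (floor i) (sparse (suc i) (m≤n⇒m≤1+n (m≤m+n i₀ k)) ≤-refl) ⟩
      floor i * (2 * 2 ^ i)                 ≡⟨ lemma' (floor i) (2 ^ i) ⟩
      2 * (2 ^ i * floor i)                 ≤⟨ *-monoʳ-≤ 2 (2^*floor≤x i) ⟩
      2 * x                                 ∎

-- Exceptional integers

-- By induction t ^ j divides n, and t ^ j ≤ z makes it divide the lcm; so it divides the gcd, and
-- the cofactor supplies one more factor t.
∣-cofactor⇒^∣ : ∀ t z {n k} .{{_ : NonZero t}} → n ≡ k * gcd n (lcmUpTo z) → t ∣ k →
                ∀ j → t ^ j ≤ z → t ^ suc j ∣ n
∣-cofactor⇒^∣ t z {n} {k} n≡kg t∣k zero    _ =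
  subst₂ _∣_ (sym (*-identityʳ t)) (sym n≡kg) (∣m⇒∣m*n _ t∣k)
∣-cofactor⇒^∣ t z {n} {k} n≡kg t∣k (suc j) t^≤z = subst (t * t ^ suc j ∣_) (sym n≡kg)
  (*-pres-∣ t∣k (gcd-greatest
    (∣-cofactor⇒^∣ t z n≡kg t∣k j (≤-trans (m≤n*m (t ^ j) t) t^≤z))
    (∣lcmUpTo z (m^n>0 t (suc j)) t^≤z)))

threshold : ℕ → ℕ → ℕ
threshold J w with J ≤? w
... | yes _ = 1
... | no  _ = 0

threshold≡0 : ∀ J w → threshold J w ≡ 0 → w < J
threshold≡0 J w eq with J ≤? w
... | no J≰w = ≰⇒> J≰w

-- The pointwise form of Markov's inequality.
*-threshold : ∀ J w → J * threshold J w ≤ w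
*-threshold J w with J ≤? w
... | yes J≤w = ≤-trans (≤-reflexive (*-identityʳ J)) J≤w
... | no  _   = ≤-trans (≤-reflexive (*-zeroʳ J)) z≤n

module Exceptional (r J : ℕ) where

  -- `z` governs the roughness of the cofactor, `Z` = z * z is the range of the lcm, and `Y` bounds
  -- the divisor that should lie in A.
  z Z Y : ℕ
  z = 2 ^ r
  Z = 2 ^ (r + r)
  Y = 2 ^ J

  1≤Z : 1 ≤ Z
  1≤Z = m^n>0 2 (r + r)

  -- The value at 0 is never used; for t ≥ 1 this is the least power of suc t exceeding Z.
  powerAbove : ℕ → ℕ
  powerAbove zero    = Z
  powerAbove (suc t) = suc (suc t) ^ suc (proj₁ (^-bracket (suc (suc t)) (s≤s (s≤s z≤n)) Z 1≤Z))

  Z≤powerAbove : ∀ t → Z ≤ powerAbove t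
  Z≤powerAbove zero    = ≤-refl
  Z≤powerAbove (suc t) = <⇒≤ (proj₂ (proj₂ (^-bracket (suc (suc t)) (s≤s (s≤s z≤n)) Z 1≤Z)))

  powerAbove-∣ : ∀ {n k t} → n ≡ k * gcd n (lcmUpTo Z) → 1 ≤ t → suc t ∣ k → powerAbove t ∣ n
  powerAbove-∣ {t = suc t} n≡kg _ t∣k with ^-bracket (suc (suc t)) (s≤s (s≤s z≤n)) Z 1≤Z
  ... | j , lo , _ = ∣-cofactor⇒^∣ (suc (suc t)) Z n≡kg t∣k j lo

  powerful : ℕ → ℕ
  powerful n = ∑ z λ t → dilate (powerAbove t) (const 1) n

  largeGcd : ℕ → ℕ
  largeGcd n = threshold J (weightSum Z n)

  -- All m ≤ Y are summed over, because the actual divisor gcd(n, lcm(1, ..., Z)) depends on n;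
  -- restricting to rough cofactors gains a factor of order 1 / r.
  leftMiss : (ℕ → ℕ) → ℕ → ℕ
  leftMiss ν n = ∑ Y λ m → dilate m (λ k → ν m * rough z k) n

  -- A crude union bound over m, affordable because the density of B is used at a precision chosen
  -- after Y.
  rightMiss : (ℕ → ℕ) → ℕ → ℕ
  rightMiss ν n = ∑ Y λ m → dilate m ν n

  -- The factors are g = gcd(n, lcm(1, ..., Z)) and k = n / g. Vanishing of `powerful` makes k
  -- rough, and vanishing of `largeGcd` gives g ≤ Y; the terms m = g of the two remaining sums then
  -- force νA g = 0 and νB k = 0.
  factorisation : ∀ νA νB n → 1 ≤ n → powerful n + largeGcd n + leftMiss νA n + rightMiss νB n ≡ 0 →
                  ∃[ a ] ∃[ b ] (νA a ≡ 0 × νB b ≡ 0 × n ≡ a * b)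
  factorisation νA νB n 1≤n ≡0 = g , k , νA≡0 , νB≡0 , trans n≡kg (*-comm k g)
    where
    s₁≡0 : powerful n + largeGcd n + leftMiss νA n ≡ 0
    s₁≡0 = m+n≡0⇒m≡0 _ ≡0
    s₂≡0 : powerful n + largeGcd n ≡ 0
    s₂≡0 = m+n≡0⇒m≡0 _ s₁≡0
    g k : ℕ
    g = gcd n (lcmUpTo Z)
    k = quotient (gcd[m,n]∣m n (lcmUpTo Z))
    n≡kg : n ≡ k * g
    n≡kg = m∣n⇒n≡quotient*m (gcd[m,n]∣m n (lcmUpTo Z))
    1≤g : 1 ≤ g
    1≤g = n≢0⇒n>0 λ eq → >⇒≢ 1≤n (gcd[m,n]≡0⇒m≡0 eq)
    instance
      g≢0 : NonZero g
      g≢0 = >-nonZero 1≤g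
    g≤Y : g ≤ Y
    g≤Y = ≤-trans (proj₁ (weightSum-bounds Z n))
      (^-monoʳ-≤ 2 (<⇒≤ (threshold≡0 J _ (m+n≡0⇒n≡0 (powerful n) s₂≡0))))
    rough≢0 : rough z k ≢ 0
    rough≢0 eq with rough≡0 z k eq
    ... | t , 1≤t , t≤z , t∣k with powerAbove-∣ n≡kg 1≤t t∣k
    ... | divides q n≡qp = contradiction
      (trans (sym (dilate-∣ (powerAbove t) (const 1) q {{>-nonZero (≤-trans 1≤Z (Z≤powerAbove t))}}))
        (trans (cong (dilate (powerAbove t) (const 1)) (sym n≡qp))
          (∑≡0⇒≡0 _ z (m+n≡0⇒m≡0 (powerful n) s₂≡0) 1≤t t≤z)))
      1+n≢0
    at-g : ∀ (f : ℕ → ℕ → ℕ) → ∑ Y (λ m → dilate m (f m) n) ≡ 0 → f g k ≡ 0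
    at-g f ∑≡0 = trans (sym (dilate-∣ g (f g) k))
      (trans (cong (dilate g (f g)) (sym n≡kg)) (∑≡0⇒≡0 (λ m → dilate m (f m) n) Y ∑≡0 1≤g g≤Y))
    νA≡0 : νA g ≡ 0
    νA≡0 with m*n≡0⇒m≡0∨n≡0 (νA g) (at-g (λ m k → νA m * rough z k) (m+n≡0⇒n≡0 (powerful n + largeGcd n) s₁≡0))
    ... | inj₁ eq = eq
    ... | inj₂ eq = contradiction eq rough≢0
    νB≡0 : νB k ≡ 0
    νB≡0 = at-g (const νB) (m+n≡0⇒n≡0 (powerful n + largeGcd n + leftMiss νA n) ≡0)

  -- There are z prescribed divisors, each at least Z = z * z.
  ∑-powerful : ∀ x → z * ∑ x powerful ≤ x
  ∑-powerful x = *-cancelˡ-≤ z {{m^n≢0 2 r}} (begin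
    z * (z * ∑ x powerful)                            ≡⟨ *-assoc z z _ ⟨
    z * z * ∑ x powerful                              ≡⟨ cong₂ _*_ (sym (^-distribˡ-+-* 2 r r)) (∑-swap (λ t → dilate (powerAbove t) (const 1)) x z) ⟩
    Z * ∑ z (λ t → multiples (powerAbove t) x)        ≡⟨ *-distribˡ-∑ Z _ z ⟩
    ∑ z (λ t → Z * multiples (powerAbove t) x)        ≤⟨ ∑-mono z (λ t _ _ → termwise t) ⟩
    ∑ z (const x)                                     ≡⟨ ∑-const x z ⟩
    z * x                                             ∎)
    where
    open ≤-Reasoning
    termwise : ∀ t → Z * multiples (powerAbove t) x ≤ x
    termwise t = begin
      Z * multiples (powerAbove t) x               ≤⟨ *-monoˡ-≤ _ (Z≤powerAbove t) ⟩
      powerAbove t * multiples (powerAbove t) x    ≡⟨ *-comm (powerAbove t) _ ⟩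
      multiples (powerAbove t) x * powerAbove t    ≤⟨ multiples-lower (powerAbove t) {{>-nonZero (≤-trans 1≤Z (Z≤powerAbove t))}} x ⟩
      x                                            ∎

  ∑-largeGcd : ∀ x → J * ∑ x largeGcd ≤ 4 * (r + r) * x
  ∑-largeGcd x = begin
    J * ∑ x largeGcd               ≡⟨ *-distribˡ-∑ J largeGcd x ⟩
    ∑ x (λ n → J * largeGcd n)     ≤⟨ ∑-mono x (λ n _ _ → *-threshold J _) ⟩
    ∑ x (weightSum Z)            ≤⟨ ∑-weightSum-≤ (r + r) x ⟩
    4 * (r + r) * x              ∎
    where open ≤-Reasoning

  -- For each m, `rough-count` is applied on [1, ⌊x / m⌋]; its additive error `suc z !` does not
  -- depend on x and accumulates to `suc z ! * Y`.
  ∑-leftMiss : ∀ ν → (∀ n → ν n ≤ 1) → ∀ x → r * ∑ x (leftMiss ν) ≤ 2 * (suc z ! * Y + ∑ Y (λ m → ν m * multiples m x))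
  ∑-leftMiss ν ν≤1 x = begin
    r * ∑ x (leftMiss ν)                                         ≡⟨ cong (r *_) (∑-swap (λ m → dilate m (λ k → ν m * rough z k)) x Y) ⟩
    r * ∑ Y (λ m → ∑ x (dilate m (λ k → ν m * rough z k)))       ≡⟨ *-distribˡ-∑ r _ Y ⟩
    ∑ Y (λ m → r * ∑ x (dilate m (λ k → ν m * rough z k)))       ≤⟨ ∑-mono Y (λ { m@(suc _) _ _ → termwise m }) ⟩
    ∑ Y (λ m → 2 * (suc z ! + ν m * multiples m x))              ≡⟨ *-distribˡ-∑ 2 _ Y ⟨
    2 * ∑ Y (λ m → suc z ! + ν m * multiples m x)                ≡⟨ cong (2 *_) (∑-distrib-+ (const (suc z !)) _ Y) ⟩
    2 * (∑ Y (const (suc z !)) + ∑ Y (λ m → ν m * multiples m x)) ≡⟨ cong (λ v → 2 * (v + ∑ Y (λ m → ν m * multiples m x))) (trans (∑-const (suc z !) Y) (*-comm Y _)) ⟩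
    2 * (suc z ! * Y + ∑ Y (λ m → ν m * multiples m x))          ∎
    where
    open ≤-Reasoning
    lemma : ∀ a b c → a * (b * c) ≡ b * (a * c)
    lemma = solve-∀
    lemma' : ∀ a b c → a * (2 * (b + c)) ≡ 2 * (a * b + a * c)
    lemma' = solve-∀
    termwise : ∀ m .{{_ : NonZero m}} → r * ∑ x (dilate m (λ k → ν m * rough z k)) ≤ 2 * (suc z ! + ν m * multiples m x)
    termwise m = begin
      r * ∑ x (dilate m (λ k → ν m * rough z k))           ≡⟨ cong (r *_) (∑-dilate m (λ k → ν m * rough z k) x) ⟩
      r * ∑ (multiples m x) (λ k → ν m * rough z k)        ≡⟨ cong (r *_) (*-distribˡ-∑ (ν m) (rough z) (multiples m x)) ⟨
      r * (ν m * ∑ (multiples m x) (rough z))              ≡⟨ lemma r (ν m) _ ⟩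
      ν m * (r * ∑ (multiples m x) (rough z))              ≤⟨ *-monoʳ-≤ (ν m) (rough-count r (multiples m x)) ⟩
      ν m * (2 * (suc z ! + multiples m x))                ≡⟨ lemma' (ν m) (suc z !) _ ⟩
      2 * (ν m * suc z ! + ν m * multiples m x)            ≤⟨ *-monoʳ-≤ 2 (+-monoˡ-≤ _ (*-monoˡ-≤ (suc z !) (ν≤1 m))) ⟩
      2 * (1 * suc z ! + ν m * multiples m x)              ≡⟨ cong (λ v → 2 * (v + ν m * multiples m x)) (*-identityˡ (suc z !)) ⟩
      2 * (suc z ! + ν m * multiples m x)                  ∎

  -- The bound N * Y ≤ x keeps ⌊x / m⌋ ≥ N for all m ≤ Y, where `sparse` applies; each of the Y
  -- values of m then costs at most x / b.
  ∑-rightMiss : ∀ ν b N x → N * Y ≤ x → (∀ y → N ≤ y → y ≤ x → b * ∑ y ν ≤ y) → b * ∑ x (rightMiss ν) ≤ Y * x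
  ∑-rightMiss ν b N x N*Y≤x sparse = begin
    b * ∑ x (rightMiss ν)                     ≡⟨ cong (b *_) (∑-swap (λ m → dilate m ν) x Y) ⟩
    b * ∑ Y (λ m → ∑ x (dilate m ν))          ≡⟨ *-distribˡ-∑ b _ Y ⟩
    ∑ Y (λ m → b * ∑ x (dilate m ν))          ≤⟨ ∑-mono Y (λ { m@(suc _) _ m≤Y → termwise m m≤Y }) ⟩
    ∑ Y (const x)                             ≡⟨ ∑-const x Y ⟩
    Y * x                                     ∎
    where
    open ≤-Reasoning
    N≤ : N ≤ multiples Y x
    N≤ = s≤s⁻¹ (*-cancelʳ-< Y N _ (≤-<-trans N*Y≤x (multiples-upper Y {{m^n≢0 2 J}} x)))
    termwise : ∀ m .{{_ : NonZero m}} → m ≤ Y → b * ∑ x (dilate m ν) ≤ x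
    termwise m m≤Y = begin
      b * ∑ x (dilate m ν)           ≡⟨ cong (b *_) (∑-dilate m ν x) ⟩
      b * ∑ (multiples m x) ν        ≤⟨ sparse _ (≤-trans N≤ (multiples-antitone x m≤Y)) mx≤x ⟩
      multiples m x                  ≤⟨ mx≤x ⟩
      x                              ∎
      where
      mx≤x : multiples m x ≤ x
      mx≤x = ≤-trans (m≤m*n (multiples m x) m) (multiples-lower m x)

-- Choice of parameters and conclusion

-- After scaling by 3 * (D * r), three error terms remain, each at most D * r * x: the period error
-- C, the initial dyadic blocks, paid for by r, and the k sparse blocks, paid for by D.
leftMiss-bound : ∀ P K D r i k C W s x .{{_ : NonZero D}} .{{_ : NonZero r}} →
  r * s ≤ 2 * (C + W) → D * W ≤ D * (suc i * x) + k * (2 * x) →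
  k ≤ K * r → 48 * P * K ≤ D → r ≡ 24 * P * suc i → 24 * P * C ≤ x → 4 * P * s ≤ x
leftMiss-bound P K D r i k C W s x rs≤ DW≤ k≤ ≤D r≡ C≤x =
  *-cancelˡ-≤ (3 * (D * r)) {{m*n≢0 3 (D * r) {{_}} {{m*n≢0 D r}}}} (begin
    3 * (D * r) * (4 * P * s)                             ≡⟨ l₁ D r P s ⟩
    12 * P * D * (r * s)                                  ≤⟨ *-monoʳ-≤ (12 * P * D) rs≤ ⟩
    12 * P * D * (2 * (C + W))                            ≡⟨ l₂ P D C W ⟩
    D * (24 * P * C) + 24 * P * (D * W)                   ≤⟨ +-mono-≤ (*-monoʳ-≤ D C≤x) (*-monoʳ-≤ (24 * P) DW≤) ⟩
    D * x + 24 * P * (D * (suc i * x) + k * (2 * x))      ≡⟨ cong (D * x +_) (l₃ P D (suc i) x k) ⟩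
    D * x + (D * (24 * P * suc i) * x + 48 * P * k * x)   ≤⟨ +-mono-≤ (*-monoˡ-≤ x (m≤m*n D r))
                                                               (+-mono-≤ (≤-reflexive (cong (λ v → D * v * x) (sym r≡)))
                                                                         (*-monoˡ-≤ x 48Pk≤)) ⟩
    D * r * x + (D * r * x + D * r * x)                   ≡⟨ l₄ (D * r) x ⟩
    3 * (D * r) * x                                       ∎)
  where
  open ≤-Reasoning
  l₁ : ∀ D r P s → 3 * (D * r) * (4 * P * s) ≡ 12 * P * D * (r * s)
  l₁ = solve-∀
  l₂ : ∀ P D C W → 12 * P * D * (2 * (C + W)) ≡ D * (24 * P * C) + 24 * P * (D * W)
  l₂ = solve-∀
  l₃ : ∀ P D i x k → 24 * P * (D * (i * x) + k * (2 * x)) ≡ D * (24 * P * i) * x + 48 * P * k * x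
  l₃ = solve-∀
  l₄ : ∀ a x → a * x + (a * x + a * x) ≡ 3 * a * x
  l₄ = solve-∀
  48Pk≤ : 48 * P * k ≤ D * r
  48Pk≤ = begin
    48 * P * k          ≤⟨ *-monoʳ-≤ (48 * P) k≤ ⟩
    48 * P * (K * r)    ≡⟨ *-assoc (48 * P) K r ⟨
    48 * P * K * r      ≤⟨ *-monoˡ-≤ r ≤D ⟩
    D * r               ∎

combine : ∀ P s₁ s₂ s₃ s₄ x → 4 * P * s₁ ≤ x → 4 * P * s₂ ≤ x → 4 * P * s₃ ≤ x → 4 * P * s₄ ≤ x →
          P * (s₁ + s₂ + s₃ + s₄) ≤ x
combine P s₁ s₂ s₃ s₄ x h₁ h₂ h₃ h₄ = *-cancelˡ-≤ 4 (begin
  4 * (P * (s₁ + s₂ + s₃ + s₄))                              ≡⟨ l P s₁ s₂ s₃ s₄ ⟩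
  4 * P * s₁ + 4 * P * s₂ + 4 * P * s₃ + 4 * P * s₄          ≤⟨ +-mono-≤ (+-mono-≤ (+-mono-≤ h₁ h₂) h₃) h₄ ⟩
  x + x + x + x                                              ≡⟨ l' x ⟩
  4 * x                                                      ∎)
  where
  open ≤-Reasoning
  l : ∀ P a b c d → 4 * (P * (a + b + c + d)) ≡ 4 * P * a + 4 * P * b + 4 * P * c + 4 * P * d
  l = solve-∀
  l' : ∀ x → x + x + x + x ≡ 4 * x
  l' = solve-∀

-- The order of choice avoids circularity: M fixes K and the precision E demanded of A, E yields the
-- threshold i, and only then come r and J. The precision for B is chosen last, after Y = 2 ^ J.
module _ (M K E i r J : ℕ) (K≡ : K ≡ 32 * suc M) (E≡ : E ≡ 48 * suc M * K)
         (r≡ : r ≡ 24 * suc M * suc i) (J≡ : J ≡ K * r) where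

  open Exceptional r J

  private
    P D : ℕ
    P = suc M
    D = suc E
    instance
      K≢0 : NonZero K
      K≢0 = subst NonZero (sym K≡) _
      r≢0 : NonZero r
      r≢0 = subst NonZero (sym r≡) _

    i≤J : i ≤ J
    i≤J = begin
      i                 ≤⟨ n≤1+n i ⟩
      suc i             ≤⟨ m≤n*m (suc i) (24 * P) ⟩
      24 * P * suc i    ≡⟨ r≡ ⟨
      r                 ≤⟨ m≤n*m r K ⟩
      K * r             ≡⟨ J≡ ⟨
      J                 ∎
      where open ≤-Reasoning

    powerful-few : ∀ x → 4 * P * ∑ x powerful ≤ x
    powerful-few x = ≤-trans (*-monoˡ-≤ (∑ x powerful) 4P≤z) (∑-powerful x)
      where
      open ≤-Reasoning
      4P≤z : 4 * P ≤ z
      4P≤z = begin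
        4 * P             ≤⟨ *-monoˡ-≤ P (m≤m+n 4 20) ⟩
        24 * P            ≤⟨ m≤m*n (24 * P) (suc i) ⟩
        24 * P * suc i    ≡⟨ r≡ ⟨
        r                 ≤⟨ <⇒≤ (n<2^n r) ⟩
        z                 ∎

    largeGcd-few : ∀ x → 4 * P * ∑ x largeGcd ≤ x
    -- Markov's inequality gives 8 r x / J, and J = 32 P r.
    largeGcd-few x = *-cancelˡ-≤ (8 * r) {{m*n≢0 8 r}} (begin
      8 * r * (4 * P * ∑ x largeGcd)     ≡⟨ l r P (∑ x largeGcd) ⟩
      32 * P * r * ∑ x largeGcd          ≡⟨ cong (λ v → v * r * ∑ x largeGcd) K≡ ⟨
      K * r * ∑ x largeGcd               ≡⟨ cong (_* ∑ x largeGcd) J≡ ⟨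
      J * ∑ x largeGcd                   ≤⟨ ∑-largeGcd x ⟩
      4 * (r + r) * x                  ≡⟨ l' r x ⟩
      8 * r * x                        ∎)
      where
      open ≤-Reasoning
      l : ∀ r P s → 8 * r * (4 * P * s) ≡ 32 * P * r * s
      l = solve-∀
      l' : ∀ r x → 4 * (r + r) * x ≡ 8 * r * x
      l' = solve-∀

    leftMiss-few : ∀ ν → (∀ n → ν n ≤ 1) → (∀ y → i ≤ y → y ≤ Y → D * ∑ y ν ≤ y) →
                   ∀ x → 24 * P * (suc z ! * Y) ≤ x → 4 * P * ∑ x (leftMiss ν) ≤ x
    leftMiss-few ν ν≤1 sparse x C≤x =
      leftMiss-bound P K D r i (J ∸ i) (suc z ! * Y) (weightedFloors ν ν≤1 x Y) (∑ x (leftMiss ν)) x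
        (∑-leftMiss ν ν≤1 x)
        (subst (λ v → D * weightedFloors ν ν≤1 x (2 ^ v) ≤ D * (suc i * x) + (J ∸ i) * (2 * x)) i+[J∸i]
          (weightedFloors-sparse ν ν≤1 x D i (J ∸ i) λ j i≤j j≤ →
            -- Sparsity is assumed from i on, and 2 ^ j > j ≥ i.
            sparse (2 ^ j) (≤-trans i≤j (<⇒≤ (n<2^n j))) (^-monoʳ-≤ 2 (subst (j ≤_) i+[J∸i] j≤))))
        (≤-trans (m∸n≤m J i) (≤-reflexive J≡))
        (≤-trans (≤-reflexive (sym E≡)) (n≤1+n E)) r≡ C≤x
      where
      i+[J∸i] : i + (J ∸ i) ≡ J
      i+[J∸i] = m+[n∸m]≡n i≤J

    rightMiss-few : ∀ ν x → suc (4 * P * Y) * ∑ x (rightMiss ν) ≤ Y * x → 4 * P * ∑ x (rightMiss ν) ≤ x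
    rightMiss-few ν x h = *-cancelˡ-≤ Y {{m^n≢0 2 J}} (begin
      Y * (4 * P * s)          ≡⟨ l Y (4 * P) s ⟩
      4 * P * Y * s            ≤⟨ *-monoˡ-≤ s (n≤1+n (4 * P * Y)) ⟩
      suc (4 * P * Y) * s      ≤⟨ h ⟩
      Y * x                    ∎)
      where
      open ≤-Reasoning
      s : ℕ
      s = ∑ x (rightMiss ν)
      l : ∀ a b c → a * (b * c) ≡ b * a * c
      l = solve-∀

    exceptional-few : ∀ νA νB N x →
      (∀ n → νA n ≤ 1) → (∀ y → i ≤ y → y ≤ Y → D * ∑ y νA ≤ y) →
      (∀ y → N ≤ y → y ≤ x → suc (4 * P * Y) * ∑ y νB ≤ y) →
      24 * P * (suc z ! * Y) + N * Y ≤ x →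
      P * ∑ x (λ n → powerful n + largeGcd n + leftMiss νA n + rightMiss νB n) ≤ x
    exceptional-few νA νB N x νA≤1 sparseA sparseB x≥ =
      ≤-trans (≤-reflexive (cong (P *_) ∑-split₄))
        (combine P (∑ x powerful) (∑ x largeGcd) (∑ x (leftMiss νA)) (∑ x (rightMiss νB)) x
          (powerful-few x) (largeGcd-few x)
          (leftMiss-few νA νA≤1 sparseA x (m+n≤o⇒m≤o (24 * P * (suc z ! * Y)) x≥))
          (rightMiss-few νB x (∑-rightMiss νB (suc (4 * P * Y)) N x (m+n≤o⇒n≤o (24 * P * (suc z ! * Y)) x≥) sparseB)))
      where
      ∑-split₄ : ∑ x (λ n → powerful n + largeGcd n + leftMiss νA n + rightMiss νB n) ≡
                 ∑ x powerful + ∑ x largeGcd + ∑ x (leftMiss νA) + ∑ x (rightMiss νB)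
      ∑-split₄ = trans (∑-distrib-+ (λ n → powerful n + largeGcd n + leftMiss νA n) (rightMiss νB) x)
        (cong (_+ ∑ x (rightMiss νB))
          (trans (∑-distrib-+ (λ n → powerful n + largeGcd n) (leftMiss νA) x)
            (cong (_+ ∑ x (leftMiss νA)) (∑-distrib-+ powerful largeGcd x))))

  product-density : ∀ {A B : Subset} →
    (∀ x → x ≥ i → ∃[ k ] (AtLeastIn A x k × D * k ≥ E * x)) → DensityOne B →
    ∃[ N ] ∀ x → x ≥ N → ∃[ k ] (AtLeastIn (A · B) x k × P * k ≥ M * x)
  product-density {A} {B} dA dB with dB (4 * P * Y) | density-weights E i dA Y
  ... | N , denseB | νA , νA≤1 , νA⇒A , sparseA = 24 * P * (suc z ! * Y) + N * Y , dense
    where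
    dense : ∀ x → x ≥ 24 * P * (suc z ! * Y) + N * Y → ∃[ k ] (AtLeastIn (A · B) x k × P * k ≥ M * x)
    -- `νA` is fixed on [1, Y] once for all x, but the cofactor in B can be as large as x, so `νB`
    -- depends on x.
    dense x x≥ with density-weights (4 * P * Y) N denseB x
    ... | νB , _ , νB⇒B , sparseB = density-from-weights M x _ zero⇒∈
      (exceptional-few νA νB N x νA≤1 sparseA sparseB x≥)
      where
      zero⇒∈ : ∀ {n} → 1 ≤ n → n ≤ x → powerful n + largeGcd n + leftMiss νA n + rightMiss νB n ≡ 0 → (A · B) n
      zero⇒∈ {n} 1≤n _ ≡0 with factorisation νA νB n 1≤n ≡0
      ... | a , b , νA≡0 , νB≡0 , n≡ab = a , b , νA⇒A a νA≡0 , νB⇒B b νB≡0 , n≡ab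

theorem1p1 : (A B : Subset) → DensityOne A → DensityOne B → DensityOne (A · B)
-- This is E = 48 P K with P = M + 1 and K = 32 P; the threshold i that it yields determines r and
-- J.
theorem1p1 A B dA dB M with dA (48 * suc M * (32 * suc M))
... | i , denseA = product-density M _ _ i _ _ refl refl refl refl denseA dB
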